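{- Let $x,y,z\in\mathbb{R}$ with $x\geq y\geq z$, let $a,b,c\in\mathbb{R}$ with $a,c\geq 0$ and $a+c\geq |b|$, and let $g:\mathbb{R}\to\mathbb{R}$ be a function in class $\mathcal{G}$. Then $$a\,g(x-y)g(x-z) + b\,g(y-z)g(y-x) + c\,g(z-x)g(z-y) \geq 0.$$
   Context: A function $g:\mathbb{R}\to\mathbb{R}$ is in class $\mathcal{G}$ if $g$ is either even or odd, $g(0)\geq 0$, and $g$ is monotonically nondecreasing on $[0,\infty)$. -}

module Defs where

open import Data.Nat.Base as ℕ using (ℕ)
import Data.Nat.Properties as ℕ
open import Data.Product.Base using (_,_; ∃; _×_)
open import Data.Rational.Base as ℚ using (ℚ; 0ℚ; 1ℚ; ½)
import Data.Rational.Properties as ℚ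
open import Data.Rational.Solver using (module +-*-Solver)
open import Data.Sum.Base using (_⊎_; inj₁; inj₂)
open import Level using (0ℓ)
open import Relation.Binary.Bundles using (Setoid)
open import Relation.Binary.PropositionalEquality
  using (_≡_; refl; sym; cong; subst)

infix  8 -_
infixl 7 _*_
infixl 6 _+_ _-_
infix  4 _≈_ _≤_ _≥_

-- The real numbers, by Cantor's construction: Cauchy sequences of rationals
-- with pointwise operations.  There are no quotients, so equality of reals is
-- the equivalence relation _≈_ below, not _≡_.

IsCauchy : (ℕ → ℚ) → Set
IsCauchy s = ∀ ε → 0ℚ ℚ.< ε →
  ∃ λ N → ∀ m n → N ℕ.≤ m → N ℕ.≤ n → ℚ.∣ s m ℚ.- s n ∣ ℚ.< ε

record ℝ : Set where
  field
    seq    : ℕ → ℚ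
    cauchy : IsCauchy seq

open ℝ public

_≈_ : ℝ → ℝ → Set
x ≈ y = ∀ ε → 0ℚ ℚ.< ε →
  ∃ λ N → ∀ n → N ℕ.≤ n → ℚ.∣ seq x n ℚ.- seq y n ∣ ℚ.< ε

-- The ε is needed: equal reals may have representatives xₙ > yₙ for all n.
_≤_ : ℝ → ℝ → Set
x ≤ y = ∀ ε → 0ℚ ℚ.< ε →
  ∃ λ N → ∀ n → N ℕ.≤ n → seq x n ℚ.≤ seq y n ℚ.+ ε

_≥_ : ℝ → ℝ → Set
x ≥ y = y ≤ x

private
  0<½* : ∀ ε → 0ℚ ℚ.< ε → 0ℚ ℚ.< ½ ℚ.* ε
  0<½* ε 0<ε = subst (ℚ._< ½ ℚ.* ε) (ℚ.*-zeroʳ ½) (ℚ.*-monoʳ-<-pos ½ 0<ε)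

  ½+½ : ∀ ε → ½ ℚ.* ε ℚ.+ ½ ℚ.* ε ≡ ε
  ½+½ = solve 1 (λ e → con ½ :* e :+ con ½ :* e := e) refl
    where open +-*-Solver

  ∣-∣-sym : ∀ p q → ℚ.∣ p ℚ.- q ∣ ≡ ℚ.∣ q ℚ.- p ∣
  ∣-∣-sym p q = subst (λ r → ℚ.∣ p ℚ.- q ∣ ≡ ℚ.∣ r ∣)
    (solve 2 (λ p q → :- (p :- q) := q :- p) refl p q)
    (sym (ℚ.∣-p∣≡∣p∣ (p ℚ.- q)))
    where open +-*-Solver

  ∣-∣-triangle : ∀ p q r → ℚ.∣ p ℚ.- r ∣ ℚ.≤ ℚ.∣ p ℚ.- q ∣ ℚ.+ ℚ.∣ q ℚ.- r ∣
  ∣-∣-triangle p q r = subst (λ t → ℚ.∣ t ∣ ℚ.≤ ℚ.∣ p ℚ.- q ∣ ℚ.+ ℚ.∣ q ℚ.- r ∣)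
    (solve 3 (λ p q r → (p :- q) :+ (q :- r) := p :- r) refl p q r)
    (ℚ.∣p+q∣≤∣p∣+∣q∣ (p ℚ.- q) (q ℚ.- r))
    where open +-*-Solver

  ∣p∣-∣q∣≤∣p-q∣ : ∀ p q → ℚ.∣ p ∣ ℚ.- ℚ.∣ q ∣ ℚ.≤ ℚ.∣ p ℚ.- q ∣
  ∣p∣-∣q∣≤∣p-q∣ p q = begin
    ℚ.∣ p ∣ ℚ.- ℚ.∣ q ∣
      ≡⟨ cong (λ t → ℚ.∣ t ∣ ℚ.- ℚ.∣ q ∣)
           (solve 2 (λ p q → p := (p :- q) :+ q) refl p q) ⟩
    ℚ.∣ (p ℚ.- q) ℚ.+ q ∣ ℚ.- ℚ.∣ q ∣
      ≤⟨ ℚ.+-monoˡ-≤ (ℚ.- ℚ.∣ q ∣) (ℚ.∣p+q∣≤∣p∣+∣q∣ (p ℚ.- q) q) ⟩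
    ℚ.∣ p ℚ.- q ∣ ℚ.+ ℚ.∣ q ∣ ℚ.- ℚ.∣ q ∣
      ≡⟨ solve 2 (λ s t → s :+ t :- t := s) refl ℚ.∣ p ℚ.- q ∣ ℚ.∣ q ∣ ⟩
    ℚ.∣ p ℚ.- q ∣ ∎
    where open ℚ.≤-Reasoning
          open +-*-Solver

  ∣∣p∣-∣q∣∣≤∣p-q∣ : ∀ p q → ℚ.∣ ℚ.∣ p ∣ ℚ.- ℚ.∣ q ∣ ∣ ℚ.≤ ℚ.∣ p ℚ.- q ∣
  ∣∣p∣-∣q∣∣≤∣p-q∣ p q with ℚ.∣p∣≡p∨∣p∣≡-p (ℚ.∣ p ∣ ℚ.- ℚ.∣ q ∣)
  ... | inj₁ eq = subst (ℚ._≤ ℚ.∣ p ℚ.- q ∣) (sym eq) (∣p∣-∣q∣≤∣p-q∣ p q)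
  ... | inj₂ eq = begin
    ℚ.∣ ℚ.∣ p ∣ ℚ.- ℚ.∣ q ∣ ∣ ≡⟨ eq ⟩
    ℚ.- (ℚ.∣ p ∣ ℚ.- ℚ.∣ q ∣)
      ≡⟨ solve 2 (λ s t → :- (s :- t) := t :- s) refl ℚ.∣ p ∣ ℚ.∣ q ∣ ⟩
    ℚ.∣ q ∣ ℚ.- ℚ.∣ p ∣       ≤⟨ ∣p∣-∣q∣≤∣p-q∣ q p ⟩
    ℚ.∣ q ℚ.- p ∣             ≡⟨ ∣-∣-sym q p ⟩
    ℚ.∣ p ℚ.- q ∣             ∎
    where open ℚ.≤-Reasoning
          open +-*-Solver

  bounded : ∀ {s} → IsCauchy s →
    ∃ λ B → ℚ.Positive B × ∃ λ N → ∀ n → N ℕ.≤ n → ℚ.∣ s n ∣ ℚ.≤ B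
  bounded {s} c with c 1ℚ (ℚ.positive⁻¹ 1ℚ)
  ... | N , h = B , pos , N , λ n N≤n → begin
    ℚ.∣ s n ∣
      ≡⟨ solve 2 (λ u v → u := v :+ (u :- v)) refl ℚ.∣ s n ∣ ℚ.∣ s N ∣ ⟩
    ℚ.∣ s N ∣ ℚ.+ (ℚ.∣ s n ∣ ℚ.- ℚ.∣ s N ∣)
      ≤⟨ ℚ.+-monoʳ-≤ ℚ.∣ s N ∣ (∣p∣-∣q∣≤∣p-q∣ (s n) (s N)) ⟩
    ℚ.∣ s N ∣ ℚ.+ ℚ.∣ s n ℚ.- s N ∣
      ≤⟨ ℚ.+-monoʳ-≤ ℚ.∣ s N ∣ (ℚ.<⇒≤ (h n N N≤n ℕ.≤-refl)) ⟩
    B ∎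
    where
    open ℚ.≤-Reasoning
    open +-*-Solver
    B = ℚ.∣ s N ∣ ℚ.+ 1ℚ
    pos : ℚ.Positive B
    pos = ℚ.nonNeg+pos⇒pos ℚ.∣ s N ∣ {{ℚ.∣-∣-nonNeg (s N)}} 1ℚ

  +-cauchy : ∀ {s t} → IsCauchy s → IsCauchy t → IsCauchy (λ n → s n ℚ.+ t n)
  +-cauchy {s} {t} cs ct ε 0<ε
    with cs (½ ℚ.* ε) (0<½* ε 0<ε) | ct (½ ℚ.* ε) (0<½* ε 0<ε)
  ... | M , hs | N , ht = M ℕ.⊔ N , λ m n ≤m ≤n → begin-strict
    ℚ.∣ (s m ℚ.+ t m) ℚ.- (s n ℚ.+ t n) ∣
      ≡⟨ cong ℚ.∣_∣ (solve 4 (λ a b c d → (a :+ b) :- (c :+ d) := (a :- c) :+ (b :- d))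
           refl (s m) (t m) (s n) (t n)) ⟩
    ℚ.∣ (s m ℚ.- s n) ℚ.+ (t m ℚ.- t n) ∣
      ≤⟨ ℚ.∣p+q∣≤∣p∣+∣q∣ (s m ℚ.- s n) (t m ℚ.- t n) ⟩
    ℚ.∣ s m ℚ.- s n ∣ ℚ.+ ℚ.∣ t m ℚ.- t n ∣
      <⟨ ℚ.+-mono-< (hs m n (ℕ.m⊔n≤o⇒m≤o M N ≤m) (ℕ.m⊔n≤o⇒m≤o M N ≤n))
                    (ht m n (ℕ.m⊔n≤o⇒n≤o M N ≤m) (ℕ.m⊔n≤o⇒n≤o M N ≤n)) ⟩
    ½ ℚ.* ε ℚ.+ ½ ℚ.* ε
      ≡⟨ ½+½ ε ⟩
    ε ∎
    where open ℚ.≤-Reasoning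
          open +-*-Solver

  neg-cauchy : ∀ {s} → IsCauchy s → IsCauchy (λ n → ℚ.- s n)
  neg-cauchy {s} cs ε 0<ε with cs ε 0<ε
  ... | N , h = N , λ m n ≤m ≤n → subst (λ t → ℚ.∣ t ∣ ℚ.< ε)
    (solve 2 (λ a b → a :- b := :- b :- :- a) refl (s n) (s m))
    (h n m ≤n ≤m)
    where open +-*-Solver

  divide : ∀ D → ℚ.Positive D → ∀ ε → 0ℚ ℚ.< ε →
    ∃ λ δ → 0ℚ ℚ.< δ × D ℚ.* δ ≡ ε
  divide D D>0 ε 0<ε = D⁻¹ ℚ.* ε , 0<δ , eq
    where
    D≢0 : ℚ.NonZero D
    D≢0 = ℚ.pos⇒nonZero D {{D>0}}
    D⁻¹ : ℚ
    D⁻¹ = ℚ.1/_ D {{D≢0}}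
    0<δ : 0ℚ ℚ.< D⁻¹ ℚ.* ε
    0<δ = ℚ.positive⁻¹ (D⁻¹ ℚ.* ε)
      {{ℚ.pos*pos⇒pos D⁻¹ {{ℚ.1/pos⇒pos D {{D>0}}}} ε {{ℚ.positive 0<ε}}}}
    open ℚ.≤-Reasoning
    eq : D ℚ.* (D⁻¹ ℚ.* ε) ≡ ε
    eq = begin-equality
      D ℚ.* (D⁻¹ ℚ.* ε) ≡⟨ ℚ.*-assoc D D⁻¹ ε ⟨
      D ℚ.* D⁻¹ ℚ.* ε   ≡⟨ cong (ℚ._* ε) (ℚ.*-inverseʳ D {{D≢0}}) ⟩
      1ℚ ℚ.* ε          ≡⟨ ℚ.*-identityˡ ε ⟩
      ε                 ∎

  ∣p*q∣<K*δ : ∀ K δ → ℚ.Positive K → ∀ p q →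
    ℚ.∣ p ∣ ℚ.≤ K → ℚ.∣ q ∣ ℚ.< δ → ℚ.∣ p ℚ.* q ∣ ℚ.< K ℚ.* δ
  ∣p*q∣<K*δ K δ K>0 p q p≤K q<δ = begin-strict
    ℚ.∣ p ℚ.* q ∣       ≡⟨ ℚ.∣p*q∣≡∣p∣*∣q∣ p q ⟩
    ℚ.∣ p ∣ ℚ.* ℚ.∣ q ∣ ≤⟨ ℚ.*-monoʳ-≤-nonNeg ℚ.∣ q ∣ {{ℚ.∣-∣-nonNeg q}} p≤K ⟩
    K ℚ.* ℚ.∣ q ∣       <⟨ ℚ.*-monoʳ-<-pos K {{K>0}} q<δ ⟩
    K ℚ.* δ             ∎
    where open ℚ.≤-Reasoning

  *-close : ∀ B C δ → ℚ.Positive B → ℚ.Positive C → ∀ p q p′ q′ →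
    ℚ.∣ p′ ∣ ℚ.≤ B → ℚ.∣ q ∣ ℚ.≤ C →
    ℚ.∣ p ℚ.- p′ ∣ ℚ.< δ → ℚ.∣ q ℚ.- q′ ∣ ℚ.< δ →
    ℚ.∣ p ℚ.* q ℚ.- p′ ℚ.* q′ ∣ ℚ.< (C ℚ.+ B) ℚ.* δ
  *-close B C δ B>0 C>0 p q p′ q′ p′≤B q≤C p∼p′ q∼q′ = begin-strict
    ℚ.∣ p ℚ.* q ℚ.- p′ ℚ.* q′ ∣
      ≡⟨ cong ℚ.∣_∣ (solve 4 (λ a b c d →
           a :* b :- c :* d := b :* (a :- c) :+ c :* (b :- d)) refl p q p′ q′) ⟩
    ℚ.∣ q ℚ.* (p ℚ.- p′) ℚ.+ p′ ℚ.* (q ℚ.- q′) ∣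
      ≤⟨ ℚ.∣p+q∣≤∣p∣+∣q∣ (q ℚ.* (p ℚ.- p′)) (p′ ℚ.* (q ℚ.- q′)) ⟩
    ℚ.∣ q ℚ.* (p ℚ.- p′) ∣ ℚ.+ ℚ.∣ p′ ℚ.* (q ℚ.- q′) ∣
      <⟨ ℚ.+-mono-< (∣p*q∣<K*δ C δ C>0 q (p ℚ.- p′) q≤C p∼p′)
                    (∣p*q∣<K*δ B δ B>0 p′ (q ℚ.- q′) p′≤B q∼q′) ⟩
    C ℚ.* δ ℚ.+ B ℚ.* δ
      ≡⟨ ℚ.*-distribʳ-+ δ C B ⟨
    (C ℚ.+ B) ℚ.* δ ∎
    where open ℚ.≤-Reasoning
          open +-*-Solver

  *-cauchy : ∀ {s t} → IsCauchy s → IsCauchy t → IsCauchy (λ n → s n ℚ.* t n)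
  *-cauchy {s} {t} cs ct ε 0<ε =
    let (B , B>0 , M , hB)  = bounded {s} cs
        (C , C>0 , N , hC)  = bounded {t} ct
        (δ , 0<δ , C+B*δ≡ε) = divide (C ℚ.+ B) (ℚ.pos+pos⇒pos C {{C>0}} B {{B>0}}) ε 0<ε
        (K , hs)            = cs δ 0<δ
        (L , ht)            = ct δ 0<δ
    in (M ℕ.⊔ N) ℕ.⊔ (K ℕ.⊔ L) , λ m n ≤m ≤n →
      let M⊔N≤m = ℕ.m⊔n≤o⇒m≤o (M ℕ.⊔ N) (K ℕ.⊔ L) ≤m
          M⊔N≤n = ℕ.m⊔n≤o⇒m≤o (M ℕ.⊔ N) (K ℕ.⊔ L) ≤n
          K⊔L≤m = ℕ.m⊔n≤o⇒n≤o (M ℕ.⊔ N) (K ℕ.⊔ L) ≤m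
          K⊔L≤n = ℕ.m⊔n≤o⇒n≤o (M ℕ.⊔ N) (K ℕ.⊔ L) ≤n
      in subst (ℚ.∣ s m ℚ.* t m ℚ.- s n ℚ.* t n ∣ ℚ.<_) C+B*δ≡ε
           (*-close B C δ B>0 C>0 (s m) (t m) (s n) (t n)
             (hB n (ℕ.m⊔n≤o⇒m≤o M N M⊔N≤n))
             (hC m (ℕ.m⊔n≤o⇒n≤o M N M⊔N≤m))
             (hs m n (ℕ.m⊔n≤o⇒m≤o K L K⊔L≤m) (ℕ.m⊔n≤o⇒m≤o K L K⊔L≤n))
             (ht m n (ℕ.m⊔n≤o⇒n≤o K L K⊔L≤m) (ℕ.m⊔n≤o⇒n≤o K L K⊔L≤n)))

  ∣∣-cauchy : ∀ {s} → IsCauchy s → IsCauchy (λ n → ℚ.∣ s n ∣)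
  ∣∣-cauchy {s} cs ε 0<ε with cs ε 0<ε
  ... | N , h = N , λ m n ≤m ≤n →
    ℚ.≤-<-trans (∣∣p∣-∣q∣∣≤∣p-q∣ (s m) (s n)) (h m n ≤m ≤n)

0ℝ : ℝ
seq    0ℝ _ = 0ℚ
cauchy 0ℝ _ 0<ε = 0 , λ _ _ _ _ → 0<ε

_+_ : ℝ → ℝ → ℝ
seq    (x + y) n = seq x n ℚ.+ seq y n
cauchy (x + y)   = +-cauchy {seq x} {seq y} (cauchy x) (cauchy y)

-_ : ℝ → ℝ
seq    (- x) n = ℚ.- seq x n
cauchy (- x)   = neg-cauchy {seq x} (cauchy x)

_-_ : ℝ → ℝ → ℝ
x - y = x + (- y)

_*_ : ℝ → ℝ → ℝ
seq    (x * y) n = seq x n ℚ.* seq y n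
cauchy (x * y)   = *-cauchy {seq x} {seq y} (cauchy x) (cauchy y)

∣_∣ : ℝ → ℝ
seq    ∣ x ∣ n = ℚ.∣ seq x n ∣
cauchy ∣ x ∣   = ∣∣-cauchy {seq x} (cauchy x)

≈-setoid : Setoid 0ℓ 0ℓ
≈-setoid = record
  { Carrier = ℝ
  ; _≈_ = _≈_
  ; isEquivalence = record
    { refl = λ {x} ε 0<ε → 0 , λ n _ →
        subst (λ t → ℚ.∣ t ∣ ℚ.< ε) (sym (ℚ.+-inverseʳ (seq x n))) 0<ε
    ; sym = λ {x} {y} x≈y ε 0<ε → let (N , h) = x≈y ε 0<ε in
        N , λ n ≤n → subst (ℚ._< ε) (∣-∣-sym (seq x n) (seq y n)) (h n ≤n)
    ; trans = λ {x} {y} {z} x≈y y≈z ε 0<ε →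
        let (M , h) = x≈y (½ ℚ.* ε) (0<½* ε 0<ε)
            (N , k) = y≈z (½ ℚ.* ε) (0<½* ε 0<ε)
        in M ℕ.⊔ N , λ n ≤n → ℚ.≤-<-trans
             (∣-∣-triangle (seq x n) (seq y n) (seq z n))
             (subst (ℚ.∣ seq x n ℚ.- seq y n ∣ ℚ.+ ℚ.∣ seq y n ℚ.- seq z n ∣ ℚ.<_) (½+½ ε)
               (ℚ.+-mono-< (h n (ℕ.m⊔n≤o⇒m≤o M N ≤n)) (k n (ℕ.m⊔n≤o⇒n≤o M N ≤n))))
    }
  }

-- Predicates on the underlying map; a function ℝ → ℝ proper is a
-- Func ≈-setoid ≈-setoid, i.e. a map that respects _≈_.

Even : (ℝ → ℝ) → Set
Even g = ∀ x → g (- x) ≈ g x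

Odd : (ℝ → ℝ) → Set
Odd g = ∀ x → g (- x) ≈ - g x

record Class𝒢 (g : ℝ → ℝ) : Set where
  field
    even⊎odd : Even g ⊎ Odd g
    g0≥0     : g 0ℝ ≥ 0ℝ
    mono     : ∀ s t → 0ℝ ≤ s → s ≤ t → g s ≤ g t

{-# OPTIONS --safe #-}

-- With P = g(x − y), Q = g(y − z), R = g(x − z), monotonicity gives 0 ≤ P ≤ R
-- and 0 ≤ Q ≤ R, and parity turns the expression into aPR ± bPQ + cQR, a sum of
-- nonnegative terms:
--   aPR ± bPQ + cQR = aP(R − Q) + cQ(R − P) + (a + c − ∣b∣)PQ + (∣b∣ ± b)PQ.

module Submission where

open import Data.Nat.Base as ℕ using (ℕ)
import Data.Nat.Properties as ℕ
open import Data.Product.Base using (_,_; ∃; _×_)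
open import Data.Rational.Base as ℚ using (ℚ; 0ℚ; 1ℚ; ½)
import Data.Rational.Properties as ℚ
open import Data.Rational.Solver using (module +-*-Solver)
open import Data.Sum.Base using (_⊎_; inj₁; inj₂)
open import Defs
open import Function.Bundles using (Func)
open import Relation.Binary.Bundles using (Setoid)
open import Relation.Binary.PropositionalEquality
  using (_≡_; refl; sym; trans; cong; subst; subst₂)
open +-*-Solver using (solve; _:+_; _:*_; _:-_; :-_; _:=_; con)
open Setoid ≈-setoid using ()
  renaming (refl to ≈-refl; sym to ≈-sym; trans to ≈-trans)

-- Properties of sequences that hold from some index on.

Eventually : (ℕ → Set) → Set
Eventually P = ∃ λ N → ∀ n → N ℕ.≤ n → P n

eventually-zip : ∀ {P Q R : ℕ → Set} → (∀ n → P n → Q n → R n) →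
  Eventually P → Eventually Q → Eventually R
eventually-zip f (M , p) (N , q) = M ℕ.⊔ N , λ n ≤n →
  f n (p n (ℕ.m⊔n≤o⇒m≤o M N ≤n)) (q n (ℕ.m⊔n≤o⇒n≤o M N ≤n))

eventually-map : ∀ {P Q : ℕ → Set} → (∀ n → P n → Q n) →
  Eventually P → Eventually Q
eventually-map f (N , p) = N , λ n ≤n → f n (p n ≤n)

-- Halving and absolute values in the rationals.

½*-pos : ∀ {ε} → 0ℚ ℚ.< ε → 0ℚ ℚ.< ½ ℚ.* ε
½*-pos {ε} 0<ε = subst (ℚ._< ½ ℚ.* ε) (ℚ.*-zeroʳ ½) (ℚ.*-monoʳ-<-pos ½ 0<ε)

½*+½* : ∀ ε → ½ ℚ.* ε ℚ.+ ½ ℚ.* ε ≡ ε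
½*+½* = solve 1 (λ e → con ½ :* e :+ con ½ :* e := e) refl

½*-< : ∀ {ε} → 0ℚ ℚ.< ε → ½ ℚ.* ε ℚ.< ε
½*-< {ε} 0<ε = subst₂ ℚ._<_ (ℚ.+-identityʳ (½ ℚ.* ε)) (½*+½* ε)
  (ℚ.+-monoʳ-< (½ ℚ.* ε) (½*-pos 0<ε))

p≤∣p∣ : ∀ p → p ℚ.≤ ℚ.∣ p ∣
p≤∣p∣ p with ℚ.≤-total 0ℚ p
... | inj₁ 0≤p = ℚ.≤-reflexive (sym (ℚ.0≤p⇒∣p∣≡p 0≤p))
... | inj₂ p≤0 = ℚ.≤-trans p≤0 (ℚ.0≤∣p∣ p)

-p≤∣p∣ : ∀ p → ℚ.- p ℚ.≤ ℚ.∣ p ∣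
-p≤∣p∣ p = subst (ℚ.- p ℚ.≤_) (ℚ.∣-p∣≡∣p∣ p) (p≤∣p∣ (ℚ.- p))

∣p∣≤ : ∀ p q → p ℚ.≤ q → ℚ.- p ℚ.≤ q → ℚ.∣ p ∣ ℚ.≤ q
∣p∣≤ p q p≤q -p≤q with ℚ.∣p∣≡p∨∣p∣≡-p p
... | inj₁ eq = subst (ℚ._≤ q) (sym eq) p≤q
... | inj₂ eq = subst (ℚ._≤ q) (sym eq) -p≤q

p≤q+r⇒p-q≤r : ∀ p q r → p ℚ.≤ q ℚ.+ r → p ℚ.- q ℚ.≤ r
p≤q+r⇒p-q≤r p q r h = subst (p ℚ.- q ℚ.≤_)
  (solve 2 (λ q r → q :+ r :- q := r) refl q r) (ℚ.+-monoˡ-≤ (ℚ.- q) h)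

p-q≤r⇒p≤q+r : ∀ p q r → p ℚ.- q ℚ.≤ r → p ℚ.≤ q ℚ.+ r
p-q≤r⇒p≤q+r p q r h = subst (ℚ._≤ q ℚ.+ r)
  (solve 2 (λ p q → q :+ (p :- q) := p) refl p q) (ℚ.+-monoʳ-≤ q h)

-- Equality and order of real numbers.

-- Operations on reals act termwise, so a polynomial identity between reals reduces to the same
-- identity over ℚ, where the ring solver applies.
pointwise-≈ : ∀ x y → (∀ n → seq x n ≡ seq y n) → x ≈ y
pointwise-≈ x y x≡y ε 0<ε = 0 , λ n _ → subst (λ t → ℚ.∣ t ∣ ℚ.< ε)
  (sym (trans (cong (ℚ._- seq y n) (x≡y n)) (ℚ.+-inverseʳ (seq y n)))) 0<ε

pointwise-≤ : ∀ x y → (∀ n → seq x n ℚ.≤ seq y n) → x ≤ y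
pointwise-≤ x y x≤y ε 0<ε = 0 , λ n _ → ℚ.≤-trans (x≤y n)
  (subst (ℚ._≤ seq y n ℚ.+ ε) (ℚ.+-identityʳ (seq y n))
    (ℚ.+-monoʳ-≤ (seq y n) (ℚ.<⇒≤ 0<ε)))

≤-reflexive : ∀ x y → x ≈ y → x ≤ y
≤-reflexive x y x≈y ε 0<ε = eventually-map (λ n h →
  p-q≤r⇒p≤q+r (seq x n) (seq y n) ε
    (ℚ.≤-trans (p≤∣p∣ (seq x n ℚ.- seq y n)) (ℚ.<⇒≤ h))) (x≈y ε 0<ε)

≤-trans : ∀ x y z → x ≤ y → y ≤ z → x ≤ z
≤-trans x y z x≤y y≤z ε 0<ε = eventually-zip (λ n h k →
  ℚ.≤-trans h (subst (seq y n ℚ.+ ½ ℚ.* ε ℚ.≤_)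
    (trans (ℚ.+-assoc (seq z n) (½ ℚ.* ε) (½ ℚ.* ε)) (cong (seq z n ℚ.+_) (½*+½* ε)))
    (ℚ.+-monoˡ-≤ (½ ℚ.* ε) k)))
  (x≤y (½ ℚ.* ε) (½*-pos 0<ε)) (y≤z (½ ℚ.* ε) (½*-pos 0<ε))

-- The order yields only weak bounds while `_≈_` asks for a strict one; running both hypotheses at
-- half of ε leaves the slack.
≤-antisym : ∀ x y → x ≤ y → y ≤ x → x ≈ y
≤-antisym x y x≤y y≤x ε 0<ε = eventually-zip (λ n h k →
  ℚ.≤-<-trans
    (∣p∣≤ (seq x n ℚ.- seq y n) (½ ℚ.* ε)
      (p≤q+r⇒p-q≤r (seq x n) (seq y n) (½ ℚ.* ε) h)
      (subst (ℚ._≤ ½ ℚ.* ε)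
        (solve 2 (λ p q → q :- p := :- (p :- q)) refl (seq x n) (seq y n))
        (p≤q+r⇒p-q≤r (seq y n) (seq x n) (½ ℚ.* ε) k)))
    (½*-< 0<ε))
  (x≤y (½ ℚ.* ε) (½*-pos 0<ε)) (y≤x (½ ℚ.* ε) (½*-pos 0<ε))

x≤y⇒0≤y-x : ∀ x y → x ≤ y → 0ℝ ≤ y - x
x≤y⇒0≤y-x x y x≤y ε 0<ε = eventually-map (λ n h →
  subst₂ ℚ._≤_ (ℚ.+-inverseʳ (seq x n))
    (solve 3 (λ p q e → q :+ e :- p := q :- p :+ e) refl (seq x n) (seq y n) ε)
    (ℚ.+-monoˡ-≤ (ℚ.- seq x n) h)) (x≤y ε 0<ε)

0≤y-x⇒x≤y : ∀ x y → 0ℝ ≤ y - x → x ≤ y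
0≤y-x⇒x≤y x y 0≤y-x ε 0<ε = eventually-map (λ n h →
  subst₂ ℚ._≤_ (ℚ.+-identityʳ (seq x n))
    (solve 3 (λ p q e → p :+ (q :- p :+ e) := q :+ e) refl (seq x n) (seq y n) ε)
    (ℚ.+-monoʳ-≤ (seq x n) h)) (0≤y-x ε 0<ε)

-- Chains 0 ≤ x ≤ x + y, the second step because the gap x + y - x is y.
0≤x+y : ∀ x y → 0ℝ ≤ x → 0ℝ ≤ y → 0ℝ ≤ x + y
0≤x+y x y 0≤x 0≤y = ≤-trans 0ℝ x (x + y) 0≤x (0≤y-x⇒x≤y x (x + y)
  (≤-trans 0ℝ y (x + y - x) 0≤y (≤-reflexive y (x + y - x)
    (pointwise-≈ y (x + y - x) λ n →
      solve 2 (λ p q → q := p :+ q :- p) refl (seq x n) (seq y n)))))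

0≤x⇒∣x∣≤x : ∀ x → 0ℝ ≤ x → ∣ x ∣ ≤ x
0≤x⇒∣x∣≤x x 0≤x ε 0<ε = eventually-map (λ n h →
  ∣p∣≤ (seq x n) (seq x n ℚ.+ ε)
    (subst (ℚ._≤ seq x n ℚ.+ ε) (ℚ.+-identityʳ (seq x n))
      (ℚ.+-monoʳ-≤ (seq x n) (ℚ.<⇒≤ 0<ε)))
    -- The bound -p ≤ p + ε amounts to 0 ≤ 2p + ε, which is twice the hypothesis 0 ≤ p + ε/2.
    (subst₂ ℚ._≤_
      (solve 1 (λ p → :- p :+ (con 0ℚ :+ con 0ℚ) := :- p) refl (seq x n))
      (solve 2 (λ p e → :- p :+ ((p :+ con ½ :* e) :+ (p :+ con ½ :* e)) := p :+ e)
        refl (seq x n) ε)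
      (ℚ.+-monoʳ-≤ (ℚ.- seq x n) (ℚ.+-mono-≤ h h))))
  (0≤x (½ ℚ.* ε) (½*-pos 0<ε))

-- A nonnegative real may have negative terms in its sequence; this exchanges it for an equal real
-- whose terms are all nonnegative.
0≤x⇒x≈∣x∣ : ∀ x → 0ℝ ≤ x → x ≈ ∣ x ∣
0≤x⇒x≈∣x∣ x 0≤x =
  ≤-antisym x ∣ x ∣ (pointwise-≤ x ∣ x ∣ λ n → p≤∣p∣ (seq x n)) (0≤x⇒∣x∣≤x x 0≤x)

-- Products: compatibility with equality, and signs.

-- Past the Cauchy threshold for 1, every term lies within 1 of the term at that threshold. Adding 1
-- also makes the bound positive, so that ε can be divided by it.
eventually-bounded : ∀ x →
  ∃ λ B → ℚ.Positive B × Eventually (λ n → ℚ.∣ seq x n ∣ ℚ.≤ B)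
eventually-bounded x with cauchy x 1ℚ (ℚ.positive⁻¹ 1ℚ)
... | N , h = ℚ.∣ seq x N ∣ ℚ.+ 1ℚ
  , ℚ.nonNeg+pos⇒pos ℚ.∣ seq x N ∣ {{ℚ.∣-∣-nonNeg (seq x N)}} 1ℚ
  , N , λ n N≤n → begin
    ℚ.∣ seq x n ∣
      ≡⟨ cong ℚ.∣_∣ (solve 2 (λ p q → p := q :+ (p :- q)) refl (seq x n) (seq x N)) ⟩
    ℚ.∣ seq x N ℚ.+ (seq x n ℚ.- seq x N) ∣
      ≤⟨ ℚ.∣p+q∣≤∣p∣+∣q∣ (seq x N) (seq x n ℚ.- seq x N) ⟩
    ℚ.∣ seq x N ∣ ℚ.+ ℚ.∣ seq x n ℚ.- seq x N ∣
      ≤⟨ ℚ.+-monoʳ-≤ ℚ.∣ seq x N ∣ (ℚ.<⇒≤ (h n N N≤n ℕ.≤-refl)) ⟩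
    ℚ.∣ seq x N ∣ ℚ.+ 1ℚ ∎
  where open ℚ.≤-Reasoning

∃-quotient : ∀ p ε → ℚ.Positive p → 0ℚ ℚ.< ε → ∃ λ δ → 0ℚ ℚ.< δ × p ℚ.* δ ≡ ε
∃-quotient p ε p>0 0<ε = p⁻¹ ℚ.* ε
  , ℚ.positive⁻¹ (p⁻¹ ℚ.* ε)
      {{ℚ.pos*pos⇒pos p⁻¹ {{ℚ.1/pos⇒pos p {{p>0}}}} ε {{ℚ.positive 0<ε}}}}
  , trans (sym (ℚ.*-assoc p p⁻¹ ε))
      (trans (cong (ℚ._* ε) (ℚ.*-inverseʳ p {{ℚ.pos⇒nonZero p {{p>0}}}}))
        (ℚ.*-identityˡ ε))
  where
  p⁻¹ : ℚ
  p⁻¹ = ℚ.1/_ p {{ℚ.pos⇒nonZero p {{p>0}}}}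

∣p*q-p*r∣<B*δ : ∀ B δ p q r → ℚ.Positive B →
  ℚ.∣ p ∣ ℚ.≤ B → ℚ.∣ q ℚ.- r ∣ ℚ.< δ → ℚ.∣ p ℚ.* q ℚ.- p ℚ.* r ∣ ℚ.< B ℚ.* δ
∣p*q-p*r∣<B*δ B δ p q r B>0 p≤B q∼r = begin-strict
  ℚ.∣ p ℚ.* q ℚ.- p ℚ.* r ∣
    ≡⟨ cong ℚ.∣_∣ (solve 3 (λ p q r → p :* q :- p :* r := p :* (q :- r)) refl p q r) ⟩
  ℚ.∣ p ℚ.* (q ℚ.- r) ∣
    ≡⟨ ℚ.∣p*q∣≡∣p∣*∣q∣ p (q ℚ.- r) ⟩
  ℚ.∣ p ∣ ℚ.* ℚ.∣ q ℚ.- r ∣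
    ≤⟨ ℚ.*-monoʳ-≤-nonNeg ℚ.∣ q ℚ.- r ∣ {{ℚ.∣-∣-nonNeg (q ℚ.- r)}} p≤B ⟩
  B ℚ.* ℚ.∣ q ℚ.- r ∣
    <⟨ ℚ.*-monoʳ-<-pos B {{B>0}} q∼r ⟩
  B ℚ.* δ ∎
  where open ℚ.≤-Reasoning

-- If the terms of x are eventually bounded by B, it suffices that y and z be within ε/B of each
-- other.
*-congˡ : ∀ x y z → y ≈ z → x * y ≈ x * z
*-congˡ x y z y≈z ε 0<ε =
  let (B , B>0 , bound) = eventually-bounded x
      (δ , 0<δ , B*δ≡ε) = ∃-quotient B ε B>0 0<ε
  in eventually-zip (λ n x≤B y∼z →
       subst (ℚ.∣ seq x n ℚ.* seq y n ℚ.- seq x n ℚ.* seq z n ∣ ℚ.<_) B*δ≡ε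
         (∣p*q-p*r∣<B*δ B δ (seq x n) (seq y n) (seq z n) B>0 x≤B y∼z))
       bound (y≈z δ 0<δ)

*-comm : ∀ x y → x * y ≈ y * x
*-comm x y = pointwise-≈ (x * y) (y * x) λ n → ℚ.*-comm (seq x n) (seq y n)

*-cong : ∀ w x y z → w ≈ x → y ≈ z → w * y ≈ x * z
*-cong w x y z w≈x y≈z = ≈-trans {w * y} {w * z} {x * z}
  (*-congˡ w y z y≈z)
  (≈-trans {w * z} {z * w} {x * z} (*-comm w z)
    (≈-trans {z * w} {z * x} {x * z} (*-congˡ z w x w≈x) (*-comm z x)))

-- The signs of individual terms are not controlled, so both factors are first replaced by their
-- absolute values; the product is then termwise an absolute value, hence nonnegative.
0≤x*y : ∀ x y → 0ℝ ≤ x → 0ℝ ≤ y → 0ℝ ≤ x * y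
0≤x*y x y 0≤x 0≤y = ≤-trans 0ℝ (∣ x ∣ * ∣ y ∣) (x * y)
  (pointwise-≤ 0ℝ (∣ x ∣ * ∣ y ∣) λ n → subst (0ℚ ℚ.≤_)
    (ℚ.∣p*q∣≡∣p∣*∣q∣ (seq x n) (seq y n)) (ℚ.0≤∣p∣ (seq x n ℚ.* seq y n)))
  (≤-reflexive (∣ x ∣ * ∣ y ∣) (x * y) (≈-sym {x * y} {∣ x ∣ * ∣ y ∣}
    (*-cong x (∣ x ∣) y (∣ y ∣) (0≤x⇒x≈∣x∣ x 0≤x) (0≤x⇒x≈∣x∣ y 0≤y))))

+-cong : ∀ w x y z → w ≈ x → y ≈ z → w + y ≈ x + z
+-cong w x y z w≈x y≈z ε 0<ε = eventually-zip (λ n h k →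
  ℚ.≤-<-trans
    (subst (λ t → ℚ.∣ t ∣ ℚ.≤ ℚ.∣ seq w n ℚ.- seq x n ∣ ℚ.+ ℚ.∣ seq y n ℚ.- seq z n ∣)
      (solve 4 (λ p q r s → (p :- q) :+ (r :- s) := (p :+ r) :- (q :+ s)) refl
        (seq w n) (seq x n) (seq y n) (seq z n))
      (ℚ.∣p+q∣≤∣p∣+∣q∣ (seq w n ℚ.- seq x n) (seq y n ℚ.- seq z n)))
    (subst (ℚ.∣ seq w n ℚ.- seq x n ∣ ℚ.+ ℚ.∣ seq y n ℚ.- seq z n ∣ ℚ.<_) (½*+½* ε)
      (ℚ.+-mono-< h k)))
  (w≈x (½ ℚ.* ε) (½*-pos 0<ε)) (y≈z (½ ℚ.* ε) (½*-pos 0<ε))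

0≤∣x∣+x : ∀ x → 0ℝ ≤ ∣ x ∣ + x
0≤∣x∣+x x = pointwise-≤ 0ℝ (∣ x ∣ + x) λ n →
  subst (ℚ._≤ ℚ.∣ seq x n ∣ ℚ.+ seq x n)
    (ℚ.+-inverseˡ (seq x n)) (ℚ.+-monoˡ-≤ (seq x n) (-p≤∣p∣ (seq x n)))

0≤∣x∣-x : ∀ x → 0ℝ ≤ ∣ x ∣ - x
0≤∣x∣-x x = x≤y⇒0≤y-x x ∣ x ∣ (pointwise-≤ x ∣ x ∣ λ n → p≤∣p∣ (seq x n))

-- The inequality for abstract values P, Q ≤ R.

-- The variable d stands for the absolute value of the original coefficient. Keeping it separate
-- makes the decomposition a polynomial identity in seven variables, and lets one lemma serve both
-- signs of b, since only d + b ≥ 0 and d ≤ a + c enter.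
weighted-products≥0 : ∀ a b c d P Q R →
  0ℝ ≤ a → 0ℝ ≤ c → d ≤ a + c → 0ℝ ≤ d + b →
  0ℝ ≤ P → 0ℝ ≤ Q → P ≤ R → Q ≤ R →
  0ℝ ≤ a * P * R + b * Q * P + c * R * Q
weighted-products≥0 a b c d P Q R 0≤a 0≤c d≤a+c 0≤d+b 0≤P 0≤Q P≤R Q≤R =
  ≤-trans 0ℝ (T₁ + T₂ + (T₃ + T₄)) (a * P * R + b * Q * P + c * R * Q)
    (0≤x+y (T₁ + T₂) (T₃ + T₄) (0≤x+y T₁ T₂ 0≤T₁ 0≤T₂) (0≤x+y T₃ T₄ 0≤T₃ 0≤T₄))
    (≤-reflexive (T₁ + T₂ + (T₃ + T₄)) (a * P * R + b * Q * P + c * R * Q)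
      (pointwise-≈ (T₁ + T₂ + (T₃ + T₄)) (a * P * R + b * Q * P + c * R * Q) λ n →
        solve 7 (λ a b c d P Q R →
          a :* P :* (R :- Q) :+ c :* Q :* (R :- P)
            :+ ((a :+ c :- d) :* (P :* Q) :+ (d :+ b) :* (P :* Q))
          := a :* P :* R :+ b :* Q :* P :+ c :* R :* Q) refl
          (seq a n) (seq b n) (seq c n) (seq d n) (seq P n) (seq Q n) (seq R n)))
  where
  T₁ T₂ T₃ T₄ : ℝ
  T₁ = a * P * (R - Q)
  T₂ = c * Q * (R - P)
  T₃ = (a + c - d) * (P * Q)
  T₄ = (d + b) * (P * Q)
  0≤T₁ : 0ℝ ≤ T₁
  0≤T₁ = 0≤x*y (a * P) (R - Q) (0≤x*y a P 0≤a 0≤P) (x≤y⇒0≤y-x Q R Q≤R)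
  0≤T₂ : 0ℝ ≤ T₂
  0≤T₂ = 0≤x*y (c * Q) (R - P) (0≤x*y c Q 0≤c 0≤Q) (x≤y⇒0≤y-x P R P≤R)
  0≤T₃ : 0ℝ ≤ T₃
  0≤T₃ = 0≤x*y (a + c - d) (P * Q) (x≤y⇒0≤y-x d (a + c) d≤a+c) (0≤x*y P Q 0≤P 0≤Q)
  0≤T₄ : 0ℝ ≤ T₄
  0≤T₄ = 0≤x*y (d + b) (P * Q) 0≤d+b (0≤x*y P Q 0≤P 0≤Q)

-- Only the three factors taken at reversed differences vary; these are the ones that parity
-- rewrites.
weighted-products-cong : ∀ a b c P Q R P₁ Q₁ R₁ P₂ Q₂ R₂ →
  P₁ ≈ P₂ → Q₁ ≈ Q₂ → R₁ ≈ R₂ →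
  a * P * R + b * Q * P₁ + c * R₁ * Q₁ ≈ a * P * R + b * Q * P₂ + c * R₂ * Q₂
weighted-products-cong a b c P Q R P₁ Q₁ R₁ P₂ Q₂ R₂ p q r =
  +-cong (a * P * R + b * Q * P₁) (a * P * R + b * Q * P₂) (c * R₁ * Q₁) (c * R₂ * Q₂)
    (+-cong (a * P * R) (a * P * R) (b * Q * P₁) (b * Q * P₂)
      (≈-refl {a * P * R}) (*-congˡ (b * Q) P₁ P₂ p))
    (*-cong (c * R₁) (c * R₂) Q₁ Q₂ (*-congˡ c R₁ R₂ r) q)

-- The primed values are those of g at y - x, z - y and z - x; evenness identifies them with P, Q
-- and R.
weighted-products-even : ∀ a b c P Q R P′ Q′ R′ →
  0ℝ ≤ a → 0ℝ ≤ c → ∣ b ∣ ≤ a + c → 0ℝ ≤ P → 0ℝ ≤ Q → P ≤ R → Q ≤ R →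
  P′ ≈ P → Q′ ≈ Q → R′ ≈ R →
  0ℝ ≤ a * P * R + b * Q * P′ + c * R′ * Q′
weighted-products-even a b c P Q R P′ Q′ R′ 0≤a 0≤c ∣b∣≤a+c 0≤P 0≤Q P≤R Q≤R p q r =
  ≤-trans 0ℝ (a * P * R + b * Q * P + c * R * Q) (a * P * R + b * Q * P′ + c * R′ * Q′)
    (weighted-products≥0 a b c ∣ b ∣ P Q R 0≤a 0≤c ∣b∣≤a+c (0≤∣x∣+x b) 0≤P 0≤Q P≤R Q≤R)
    (≤-reflexive (a * P * R + b * Q * P + c * R * Q) (a * P * R + b * Q * P′ + c * R′ * Q′)
      (weighted-products-cong a b c P Q R P Q R P′ Q′ R′
        (≈-sym {P′} {P} p) (≈-sym {Q′} {Q} q) (≈-sym {R′} {R} r)))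

-- The two sign changes in the c term cancel, and the single one in the b term moves onto b. The
-- even form then applies with -b, still with d = `∣ b ∣`, because `∣ b ∣ - b` unfolds to
-- `∣ b ∣ + (- b)`.
weighted-products-odd : ∀ a b c P Q R P′ Q′ R′ →
  0ℝ ≤ a → 0ℝ ≤ c → ∣ b ∣ ≤ a + c → 0ℝ ≤ P → 0ℝ ≤ Q → P ≤ R → Q ≤ R →
  P′ ≈ - P → Q′ ≈ - Q → R′ ≈ - R →
  0ℝ ≤ a * P * R + b * Q * P′ + c * R′ * Q′
weighted-products-odd a b c P Q R P′ Q′ R′ 0≤a 0≤c ∣b∣≤a+c 0≤P 0≤Q P≤R Q≤R p q r =
  ≤-trans 0ℝ S (a * P * R + b * Q * P′ + c * R′ * Q′)
    (weighted-products≥0 a (- b) c ∣ b ∣ P Q R 0≤a 0≤c ∣b∣≤a+c (0≤∣x∣-x b) 0≤P 0≤Q P≤R Q≤R)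
    (≤-trans S T (a * P * R + b * Q * P′ + c * R′ * Q′)
      (≤-reflexive S T (pointwise-≈ S T λ n → solve 6 (λ a b c P Q R →
        a :* P :* R :+ (:- b) :* Q :* P :+ c :* R :* Q
        := a :* P :* R :+ b :* Q :* (:- P) :+ c :* (:- R) :* (:- Q)) refl
        (seq a n) (seq b n) (seq c n) (seq P n) (seq Q n) (seq R n)))
      (≤-reflexive T (a * P * R + b * Q * P′ + c * R′ * Q′)
        (weighted-products-cong a b c P Q R (- P) (- Q) (- R) P′ Q′ R′
          (≈-sym {P′} { - P} p) (≈-sym {Q′} { - Q} q) (≈-sym {R′} { - R} r))))
  where
  S T : ℝ
  S = a * P * R + (- b) * Q * P + c * R * Q
  T = a * P * R + b * Q * (- P) + c * (- R) * (- Q)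

-- Values of g at the differences of x, y and z.

theorem1 : (x y z : ℝ) → x ≥ y → y ≥ z →
    (a b c : ℝ) → a ≥ 0ℝ → c ≥ 0ℝ → a + c ≥ ∣ b ∣ →
    (𝐠 : Func ≈-setoid ≈-setoid) → let g = Func.to 𝐠 in
    Class𝒢 g →
    a * g (x - y) * g (x - z) + b * g (y - z) * g (y - x) + c * g (z - x) * g (z - y) ≥ 0ℝ
theorem1 x y z x≥y y≥z a b c a≥0 c≥0 a+c≥∣b∣ 𝐠 g∈𝒢 = by-parity even⊎odd
  where
  open Class𝒢 g∈𝒢
  g : ℝ → ℝ
  g = Func.to 𝐠

  0≤x-y : 0ℝ ≤ x - y
  0≤x-y = x≤y⇒0≤y-x y x x≥y
  0≤y-z : 0ℝ ≤ y - z
  0≤y-z = x≤y⇒0≤y-x z y y≥z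

  g≥0 : ∀ t → 0ℝ ≤ t → 0ℝ ≤ g t
  g≥0 t 0≤t = ≤-trans 0ℝ (g 0ℝ) (g t) g0≥0
    (mono 0ℝ t (pointwise-≤ 0ℝ 0ℝ λ _ → ℚ.≤-refl) 0≤t)

  g[x-y]≤g[x-z] : g (x - y) ≤ g (x - z)
  -- The gap between the two arguments is y - z.
  g[x-y]≤g[x-z] = mono (x - y) (x - z) 0≤x-y (0≤y-x⇒x≤y (x - y) (x - z)
    (≤-trans 0ℝ (y - z) ((x - z) - (x - y)) 0≤y-z
      (≤-reflexive (y - z) ((x - z) - (x - y))
        (pointwise-≈ (y - z) ((x - z) - (x - y)) λ n →
          solve 3 (λ x y z → y :- z := (x :- z) :- (x :- y)) refl
            (seq x n) (seq y n) (seq z n)))))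

  g[y-z]≤g[x-z] : g (y - z) ≤ g (x - z)
  -- Here the gap is x - y.
  g[y-z]≤g[x-z] = mono (y - z) (x - z) 0≤y-z (0≤y-x⇒x≤y (y - z) (x - z)
    (≤-trans 0ℝ (x - y) ((x - z) - (y - z)) 0≤x-y
      (≤-reflexive (x - y) ((x - z) - (y - z))
        (pointwise-≈ (x - y) ((x - z) - (y - z)) λ n →
          solve 3 (λ x y z → x :- y := (x :- z) :- (y :- z)) refl
            (seq x n) (seq y n) (seq z n)))))

  -- The two arguments are equal reals but not identical terms, so the fact that g respects `_≈_` is
  -- what carries the equality through; parity can then be applied at s - t.
  g-swap : ∀ s t → g (t - s) ≈ g (- (s - t))
  g-swap s t = Func.cong 𝐠 {t - s} { - (s - t)} (pointwise-≈ (t - s) (- (s - t)) λ n →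
    solve 2 (λ s t → t :- s := :- (s :- t)) refl (seq s n) (seq t n))

  by-parity : Even g ⊎ Odd g →
    a * g (x - y) * g (x - z) + b * g (y - z) * g (y - x) + c * g (z - x) * g (z - y) ≥ 0ℝ
  by-parity (inj₁ even) = weighted-products-even a b c
    (g (x - y)) (g (y - z)) (g (x - z)) (g (y - x)) (g (z - y)) (g (z - x))
    a≥0 c≥0 a+c≥∣b∣ (g≥0 (x - y) 0≤x-y) (g≥0 (y - z) 0≤y-z)
    g[x-y]≤g[x-z] g[y-z]≤g[x-z] (flip x y) (flip y z) (flip x z)
    where
    flip : ∀ s t → g (t - s) ≈ g (s - t)
    flip s t = ≈-trans {g (t - s)} {g (- (s - t))} {g (s - t)} (g-swap s t) (even (s - t))
  by-parity (inj₂ odd) = weighted-products-odd a b c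
    (g (x - y)) (g (y - z)) (g (x - z)) (g (y - x)) (g (z - y)) (g (z - x))
    a≥0 c≥0 a+c≥∣b∣ (g≥0 (x - y) 0≤x-y) (g≥0 (y - z) 0≤y-z)
    g[x-y]≤g[x-z] g[y-z]≤g[x-z] (flip x y) (flip y z) (flip x z)
    where
    flip : ∀ s t → g (t - s) ≈ - g (s - t)
    flip s t = ≈-trans {g (t - s)} {g (- (s - t))} { - g (s - t)} (g-swap s t) (odd (s - t))
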